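{- Let $k\ge 2$, let $G$ be a $k$-uniform hypergraph with $n$ vertices and $H$ a $k$-uniform hypergraph with $m$ vertices. For a $k$-uniform hypergraph $F$ let $\mathbb{A}(F)$, $\mathbb{D}(F)$, $\mathbb{L}(F)=\mathbb{D}(F)-\mathbb{A}(F)$ and $\mathbb{Q}(F)=\mathbb{D}(F)+\mathbb{A}(F)$ be its adjacency tensor, degree diagonal tensor, Laplacian tensor and signless Laplacian tensor. Let $G\Box H$ be the Cartesian product of $G$ and $H$, with its vertices ordered by the lexicographic ordering of the elements of $V(G)\times V(H)$. Then: (1) the adjacency tensor of $G\Box H$ is $\mathbb{A}(G\Box H)=\mathbb{A}(G)\otimes\mathbb{I}_m+\mathbb{I}_n\otimes\mathbb{A}(H)$; (2) the degree diagonal tensor of $G\Box H$ is $\mathbb{D}(G\Box H)=\mathbb{D}(G)\otimes\mathbb{I}_m+\mathbb{I}_n\otimes\mathbb{D}(H)$; (3) the Laplacian tensor of $G\Box H$ is $\mathbb{L}(G\Box H)=\mathbb{L}(G)\otimes\mathbb{I}_m+\mathbb{I}_n\otimes\mathbb{L}(H)$; (4) the signless Laplacian tensor of $G\Box H$ is $\mathbb{Q}(G\Box H)=\mathbb{Q}(G)\otimes\mathbb{I}_m+\mathbb{I}_n\otimes\mathbb{Q}(H)$.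
   Context: A $k$-uniform hypergraph $F=(V,E)$ has a finite nonempty vertex set $V$ and a set $E$ of edges, each edge being a $k$-element subset of $V$. The Cartesian product $G\Box H$ has vertex set $V(G)\times V(H)$, and $\{(i_1,j_1),\dots,(i_k,j_k)\}$ is an edge if and only if either $i_1=\cdots=i_k$ and $\{j_1,\dots,j_k\}\in E(H)$, or $j_1=\cdots=j_k$ and $\{i_1,\dots,i_k\}\in E(G)$. An order $k$ dimension $N$ tensor is an array $\mathbb{T}=(t_{i_1\cdots i_k})$ with indices in an (ordered) $N$-element set. For a $k$-uniform hypergraph $F$, the adjacency tensor $\mathbb{A}(F)$ (indexed by $V(F)$) has entries $a_{i_1\cdots i_k}=\frac{1}{(k-1)!}$ if $\{i_1,\dots,i_k\}\in E(F)$ (so the $i_j$ are distinct) and $0$ otherwise; $\mathbb{D}(F)$ is the order $k$ tensor with $d_{i\cdots i}$ equal to the degree of $i$ (the number of edges containing $i$) and all other entries $0$. $\mathbb{I}_n$ is the order $k$ dimension $n$ unit tensor (entry $1$ when all indices are equal, $0$ otherwise). For order $k$ tensors $\mathbb{S}=(s_{i_1\cdots i_k})$ of dimension $n$ and $\mathbb{T}=(t_{j_1\cdots j_k})$ of dimension $m$, the direct product $\mathbb{S}\otimes\mathbb{T}$ is the order $k$ dimension $nm$ tensor, with index set $[n]\times[m]$ in lexicographic order (where $[n]=\{1,\dots,n\}$), given by $(\mathbb{S}\otimes\mathbb{T})_{(i_1,j_1)\cdots(i_k,j_k)}=s_{i_1\cdots i_k}t_{j_1\cdots j_k}$. -}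

module Defs where

open import Data.Bool.Base using (if_then_else_)
open import Data.Fin.Base using (Fin; quotient; remainder)
open import Data.Fin.Properties using (_≟_)
open import Data.Fin.Subset using (Subset; inside; outside; ⁅_⁆; ⋃; ∣_∣)
open import Data.Fin.Subset.Properties using (_∈?_)
open import Data.Integer.Base using (+_)
open import Data.List.Base as List using (List; allFin; filter)
open import Data.List.Relation.Unary.AllPairs using (AllPairs; allPairs?)
open import Data.Nat.Base as ℕ using (ℕ; zero; suc; NonZero; _∸_; _!)
open import Data.Nat.Properties as ℕ using (_!≢0; m*n≢0)
open import Data.Product.Base using (_×_; proj₁)
open import Data.Rational.Base using (ℚ; 0ℚ; 1ℚ; _/_; _+_; _-_; _*_)
open import Data.Sum.Base using (_⊎_)
open import Data.Vec.Base as Vec using (Vec; []; _∷_)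
open import Data.Vec.Relation.Unary.All as All using ()
open import Level using (0ℓ)
open import Relation.Binary.PropositionalEquality using (_≡_)
open import Relation.Nullary.Decidable using (does; _×-dec_; _⊎-dec_)
open import Relation.Unary using (Pred; Decidable)

-- The vertex set of a hypergraph with n vertices is Fin n, whose order is the
-- one used to index tensors.  Edges are a decidable set of subsets, so that
-- they can be counted and tested.
record Hypergraph (k n : ℕ) : Set₁ where
  field
    nonEmpty : NonZero n
    Edge     : Pred (Subset n) 0ℓ
    Edge?    : Decidable Edge
    uniform  : ∀ {e} → Edge e → ∣ e ∣ ≡ k

open Hypergraph public

subsets : ∀ n → List (Subset n)
subsets zero    = [] List.∷ List.[]
subsets (suc n) =
  List.map (outside ∷_) (subsets n) List.++ List.map (inside ∷_) (subsets n)

degree : ∀ {k n} → Hypergraph k n → Fin n → ℕ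
degree {n = n} F i =
  List.length (filter (λ e → Edge? F e ×-dec (i ∈? e)) (subsets n))

-- The set {i₁,…,iᵣ}; repeated entries are identified.
setOf : ∀ {n} → List (Fin n) → Subset n
setOf is = ⋃ (List.map ⁅_⁆ is)

elements : ∀ {n} → Subset n → List (Fin n)
elements S = filter (_∈? S) (allFin _)

-- Fin (n * m) is Fin n × Fin m in lexicographic order: the vertex x stands for
-- the pair (quotient m x , remainder m x), as in Data.Fin.Base.combine.
fsts : ∀ {n m} → Subset (n ℕ.* m) → List (Fin n)
fsts {m = m} S = List.map (quotient m) (elements S)

snds : ∀ {n m} → Subset (n ℕ.* m) → List (Fin m)
snds {n} {m} S = List.map (remainder {n} m) (elements S)

-- For S = {(i₁,j₁),…,(iₖ,jₖ)}, the lists fsts S and snds S are i₁,…,iₖ and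
-- j₁,…,jₖ, with repetitions kept.
infixl 7 _□_
_□_ : ∀ {k n m} → Hypergraph k n → Hypergraph k m → Hypergraph k (n ℕ.* m)
_□_ {k} {n} {m} G H = record
  { nonEmpty = m*n≢0 n m {{nonEmpty G}} {{nonEmpty H}}
  ; Edge     = λ S → ∣ S ∣ ≡ k ×
      ( (AllPairs _≡_ (fsts {n} {m} S) × Edge H (setOf (snds {n} {m} S)))
      ⊎ (AllPairs _≡_ (snds {n} {m} S) × Edge G (setOf (fsts {n} {m} S))))
  ; Edge?    = λ S → (∣ S ∣ ℕ.≟ k) ×-dec
      ( (allPairs? _≟_ (fsts {n} {m} S) ×-dec Edge? H (setOf (snds {n} {m} S)))
      ⊎-dec
        (allPairs? _≟_ (snds {n} {m} S) ×-dec Edge? G (setOf (fsts {n} {m} S))))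
  ; uniform  = proj₁
  }

-- Every tensor considered here has rational entries.
Tensor : ℕ → ℕ → Set
Tensor k N = Vec (Fin N) k → ℚ

infixl 6 _⊕_ _⊖_
_⊕_ _⊖_ : ∀ {k N} → Tensor k N → Tensor k N → Tensor k N
(S ⊕ T) is = S is + T is
(S ⊖ T) is = S is - T is

infixl 7 _⊗_
_⊗_ : ∀ {k n m} → Tensor k n → Tensor k m → Tensor k (n ℕ.* m)
_⊗_ {n = n} {m} S T xs =
  S (Vec.map (quotient m) xs) * T (Vec.map (remainder {n} m) xs)

-- Entry d i at (i,…,i) and 0 elsewhere; order 0 is given a junk value.
diagonal : ∀ {k N} → (Fin N → ℚ) → Tensor k N
diagonal d []       = 0ℚ
diagonal d (i ∷ is) = if does (All.all? (i ≟_) is) then d i else 0ℚ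

𝕀 : ∀ {k} n → Tensor k n
𝕀 n = diagonal (λ _ → 1ℚ)

-- ℚˢ F is the signless Laplacian tensor; ℚ itself denotes the rationals.
𝔸 𝔻 𝕃 ℚˢ : ∀ {k n} → Hypergraph k n → Tensor k n
𝔸 {k} F is =
  if does (Edge? F (setOf (Vec.toList is)))
  then _/_ (+ 1) ((k ∸ 1) !) {{(k ∸ 1) !≢0}}
  else 0ℚ
𝔻 F = diagonal (λ i → + degree F i / 1)
𝕃 F = 𝔻 F ⊖ 𝔸 F
ℚˢ F = 𝔻 F ⊕ 𝔸 F

{-# OPTIONS --safe #-}

-- An edge of G □ H is an edge of G placed in one copy of G, or an edge of H
-- placed in one copy of H; since k ≥ 2, a set of k vertices cannot be constant
-- in the coordinate that traces an edge, so the two kinds exclude each other.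
-- At an index tuple this turns 𝔸 (G □ H) into a sum of two products of
-- indicators.  The edges through (i , j) are in bijection with the edges of G
-- through i together with the edges of H through j, which gives 𝔻 (G □ H).
-- The claims on 𝕃 and ℚˢ follow by bilinearity of ⊗.
module Submission where

open import Defs
open import Data.Bool.Base using (if_then_else_)
open import Data.Fin.Base as Fin using (Fin; combine; quotient; remainder)
open import Data.Fin.Properties using (_≟_; remQuot-combine; combine-remQuot)
open import Data.Fin.Subset using (Subset; inside; outside; _∈_; _∪_; ⁅_⁆; ∣_∣)
open import Data.Fin.Subset.Properties using
  (_∈?_; ∉⊥; x∈⁅x⁆; x∈⁅y⁆⇒x≡y; ∣⁅x⁆∣≡1; ∣⊥∣≡0; ⊆-antisym; x∈p∪q⁻; x∈p∪q⁺;
   drop-there)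
open import Data.Integer.Base as ℤ using (+_)
import Data.Integer.Properties as ℤ
open import Data.List.Base as List
  using (List; []; _∷_; _++_; length; filter; tabulate)
open import Data.List.Membership.Propositional using () renaming (_∈_ to _∈ˡ_)
open import Data.List.Membership.Propositional.Properties using
  (∈-map⁺; ∈-map⁻; ∈-filter⁺; ∈-filter⁻; ∈-allFin; ∈-++⁺ˡ; ∈-++⁺ʳ; ∈-++⁻)
open import Data.List.Membership.Propositional.Properties.WithK
  using (unique∧set⇒bag)
open import Data.List.Properties using
  (filter-accept; filter-reject; length-map; length-++; map-∘; map-cong; map-id)
open import Data.List.Relation.Binary.BagAndSetEquality using (∼bag⇒↭)
open import Data.List.Relation.Binary.Permutation.Propositional.Properties
  using (↭-length)
open import Data.List.Relation.Binary.Subset.Propositional using (_⊆_)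
open import Data.List.Relation.Binary.Subset.Propositional.Properties
  using (map⁺)
open import Data.List.Relation.Unary.All as All using ([]; _∷_)
open import Data.List.Relation.Unary.AllPairs as AllPairs
  using (AllPairs; []; _∷_; allPairs?)
import Data.List.Relation.Unary.AllPairs.Properties as AllPairsP
open import Data.List.Relation.Unary.Any using (here; there)
open import Data.List.Relation.Unary.Unique.Propositional using (Unique)
import Data.List.Relation.Unary.Unique.Propositional.Properties as Unique
open import Data.Nat.Base as ℕ using (ℕ; zero; suc; _≤_; z≤n; s≤s; _!; _∸_)
open import Data.Nat.Properties as ℕ using (_!≢0)
open import Data.Product.Base using (_×_; _,_; proj₁; proj₂; ∃)
open import Data.Rational.Base using (ℚ; 0ℚ; 1ℚ; _/_; _+_; _-_; _*_; toℚᵘ)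
open import Data.Rational.Properties as ℚ
  using (toℚᵘ-injective; toℚᵘ-fromℚᵘ; toℚᵘ-homo-+)
import Data.Rational.Solver as ℚSolver
import Data.Rational.Unnormalised.Base as ℚᵘ
import Data.Rational.Unnormalised.Properties as ℚᵘ
open import Data.Sum.Base using (_⊎_; inj₁; inj₂)
open import Data.Vec.Base as Vec using (Vec; toList)
open import Data.Vec.Properties using (toList-map; length-toList)
import Data.Vec.Relation.Unary.All as VecAll
import Data.Vec.Relation.Unary.All.Properties as VecAll
open import Function.Base using (_∘_; id; flip)
open import Function.Bundles using (_⇔_; mk⇔; Equivalence)
open import Relation.Binary.PropositionalEquality
open import Relation.Nullary using (¬_; Dec; yes; no; does; contradiction)
open import Relation.Nullary.Decidable using (does-⇔; _×-dec_; _⊎-dec_)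
open import Relation.Unary using (Decidable)

open Equivalence using (to; from)

-- Lists as finite sets

-- Degrees are lengths of lists of edges, so counting by bijection reduces to mutual inclusion:
-- duplicate-free lists with the same members are permutations of each other.
length-set≡ : ∀ {A : Set} {xs ys : List A} → Unique xs → Unique ys →
              xs ⊆ ys → ys ⊆ xs → length xs ≡ length ys
length-set≡ xs! ys! xs⊆ys ys⊆xs =
  ↭-length (∼bag⇒↭ (unique∧set⇒bag xs! ys! (mk⇔ xs⊆ys ys⊆xs)))

-- `AllPairs` compares earlier positions with later ones only. The version by membership forgets
-- positions, so it can be carried between lists with the same elements.
allPairs-≡⇒≡ : ∀ {A : Set} {xs : List A} → AllPairs _≡_ xs →
               ∀ {x y} → x ∈ˡ xs → y ∈ˡ xs → x ≡ y
allPairs-≡⇒≡ (_   ∷ _)  (here refl) (here refl) = refl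
allPairs-≡⇒≡ (x≡s ∷ _)  (here refl) (there y∈)  = All.lookup x≡s y∈
allPairs-≡⇒≡ (x≡s ∷ _)  (there x∈)  (here refl) = sym (All.lookup x≡s x∈)
allPairs-≡⇒≡ (_   ∷ ps) (there x∈)  (there y∈)  = allPairs-≡⇒≡ ps x∈ y∈

≡⇒allPairs-≡ : ∀ {A : Set} (xs : List A) →
               (∀ {x y} → x ∈ˡ xs → y ∈ˡ xs → x ≡ y) → AllPairs _≡_ xs
≡⇒allPairs-≡ []       _  = []
≡⇒allPairs-≡ (x ∷ xs) eq =
  All.tabulate (eq (here refl) ∘ there) ∷
  ≡⇒allPairs-≡ xs (λ x∈ y∈ → eq (there x∈) (there y∈))

allPairs-≡-resp-⊇ : ∀ {A : Set} {xs ys : List A} → xs ⊆ ys →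
                    AllPairs _≡_ ys → AllPairs _≡_ xs
allPairs-≡-resp-⊇ xs⊆ys ps =
  ≡⇒allPairs-≡ _ (λ x∈ y∈ → allPairs-≡⇒≡ ps (xs⊆ys x∈) (xs⊆ys y∈))

∈-setOf⁻ : ∀ {n} (xs : List (Fin n)) {x} → x ∈ setOf xs → x ∈ˡ xs
∈-setOf⁻ []       x∈ = contradiction x∈ ∉⊥
∈-setOf⁻ (y ∷ ys) x∈ with x∈p∪q⁻ _ (setOf ys) x∈
... | inj₁ x∈y  = here (x∈⁅y⁆⇒x≡y y x∈y)
... | inj₂ x∈ys = there (∈-setOf⁻ ys x∈ys)

∈-setOf⁺ : ∀ {n} {xs : List (Fin n)} {x} → x ∈ˡ xs → x ∈ setOf xs
∈-setOf⁺ (here refl) = x∈p∪q⁺ (inj₁ (x∈⁅x⁆ _))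
∈-setOf⁺ (there x∈)  = x∈p∪q⁺ (inj₂ (∈-setOf⁺ x∈))

∈-elements⁺ : ∀ {n} {S : Subset n} {x} → x ∈ S → x ∈ˡ elements S
∈-elements⁺ {S = S} {x} = ∈-filter⁺ (_∈? S) (∈-allFin x)

∈-elements⁻ : ∀ {n} (S : Subset n) {x} → x ∈ˡ elements S → x ∈ S
∈-elements⁻ S x∈ = proj₂ (∈-filter⁻ (_∈? S) {xs = List.allFin _} x∈)

setOf-cong : ∀ {n} {xs ys : List (Fin n)} → xs ⊆ ys → ys ⊆ xs →
             setOf xs ≡ setOf ys
setOf-cong xs⊆ys ys⊆xs = ⊆-antisym
  (∈-setOf⁺ ∘ xs⊆ys ∘ ∈-setOf⁻ _) (∈-setOf⁺ ∘ ys⊆xs ∘ ∈-setOf⁻ _)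

setOf-elements : ∀ {n} (S : Subset n) → setOf (elements S) ≡ S
setOf-elements S =
  ⊆-antisym (∈-elements⁻ S ∘ ∈-setOf⁻ _) (∈-setOf⁺ ∘ ∈-elements⁺)

elements-setOf-⊆ : ∀ {n} (xs : List (Fin n)) → elements (setOf xs) ⊆ xs
elements-setOf-⊆ xs = ∈-setOf⁻ xs ∘ ∈-elements⁻ _

⊆-elements-setOf : ∀ {n} (xs : List (Fin n)) → xs ⊆ elements (setOf xs)
⊆-elements-setOf xs = ∈-elements⁺ ∘ ∈-setOf⁺

-- Passing to `elements` of the set only sorts and removes repetitions, which leaves the set of
-- images unchanged. This connects the lists in the definition of `□` with index tuples.
setOf-map-elements : ∀ {n a} (f : Fin n → Fin a) (xs : List (Fin n)) →
  setOf (List.map f (elements (setOf xs))) ≡ setOf (List.map f xs)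
setOf-map-elements f xs =
  setOf-cong (map⁺ f (elements-setOf-⊆ xs)) (map⁺ f (⊆-elements-setOf xs))

-- Sizes of sets given by lists

∣p∪q∣≤∣p∣+∣q∣ : ∀ {n} (p q : Subset n) → ∣ p ∪ q ∣ ≤ ∣ p ∣ ℕ.+ ∣ q ∣
∣p∪q∣≤∣p∣+∣q∣ Vec.[]            Vec.[]            = z≤n
∣p∪q∣≤∣p∣+∣q∣ (outside Vec.∷ p) (outside Vec.∷ q) = ∣p∪q∣≤∣p∣+∣q∣ p q
∣p∪q∣≤∣p∣+∣q∣ (inside  Vec.∷ p) (outside Vec.∷ q) = s≤s (∣p∪q∣≤∣p∣+∣q∣ p q)
∣p∪q∣≤∣p∣+∣q∣ (outside Vec.∷ p) (inside  Vec.∷ q) =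
  ℕ.≤-trans (s≤s (∣p∪q∣≤∣p∣+∣q∣ p q)) (ℕ.≤-reflexive (sym (ℕ.+-suc ∣ p ∣ ∣ q ∣)))
∣p∪q∣≤∣p∣+∣q∣ (inside  Vec.∷ p) (inside  Vec.∷ q) =
  s≤s (ℕ.≤-trans (∣p∪q∣≤∣p∣+∣q∣ p q) (ℕ.+-monoʳ-≤ ∣ p ∣ (ℕ.n≤1+n ∣ q ∣)))

∣setOf∣≤length : ∀ {n} (xs : List (Fin n)) → ∣ setOf xs ∣ ≤ length xs
∣setOf∣≤length {n} []   = ℕ.≤-reflexive (∣⊥∣≡0 n)
∣setOf∣≤length (x ∷ xs) = ℕ.≤-trans (∣p∪q∣≤∣p∣+∣q∣ ⁅ x ⁆ (setOf xs))
  (ℕ.+-mono-≤ (ℕ.≤-reflexive (∣⁅x⁆∣≡1 x)) (∣setOf∣≤length xs))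

-- Stated for an arbitrary `f`, because the induction on `S` replaces `f` by `f ∘ Fin.suc`.
length-filter-tabulate : ∀ {A : Set} {P : A → Set} (P? : Decidable P)
  {n} (f : Fin n → A) (S : Subset n) → (∀ i → P (f i) ⇔ i ∈ S) →
  length (filter P? (tabulate f)) ≡ ∣ S ∣
length-filter-tabulate P? f Vec.[] P⇔∈ = refl
length-filter-tabulate P? f (inside Vec.∷ S) P⇔∈ = trans
  (cong length (filter-accept P? (from (P⇔∈ Fin.zero) Vec.here)))
  (cong suc (length-filter-tabulate P? (f ∘ Fin.suc) S λ i →
    mk⇔ (drop-there ∘ to (P⇔∈ _)) (from (P⇔∈ _) ∘ Vec.there)))
length-filter-tabulate P? f (outside Vec.∷ S) P⇔∈ = trans
  (cong length (filter-reject P? λ p → contradiction (to (P⇔∈ Fin.zero) p) λ ()))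
  (length-filter-tabulate P? (f ∘ Fin.suc) S λ i →
    mk⇔ (drop-there ∘ to (P⇔∈ _)) (from (P⇔∈ _) ∘ Vec.there))

length-elements : ∀ {n} (S : Subset n) → length (elements S) ≡ ∣ S ∣
length-elements S = length-filter-tabulate (_∈? S) id S (λ _ → mk⇔ id id)

-- The length of `elements` is exactly the size of the set, and mapping keeps the length.
∣setOf-map∣≤ : ∀ {n a} (f : Fin n → Fin a) (xs : List (Fin n)) →
               ∣ setOf (List.map f xs) ∣ ≤ ∣ setOf xs ∣
∣setOf-map∣≤ f xs = begin
  ∣ setOf (List.map f xs) ∣                    ≡⟨ cong ∣_∣ (setOf-map-elements f xs) ⟨
  ∣ setOf (List.map f (elements (setOf xs))) ∣ ≤⟨ ∣setOf∣≤length (List.map f (elements (setOf xs))) ⟩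
  length (List.map f (elements (setOf xs)))    ≡⟨ length-map f (elements (setOf xs)) ⟩
  length (elements (setOf xs))                 ≡⟨ length-elements (setOf xs) ⟩
  ∣ setOf xs ∣                                 ∎
  where open ℕ.≤-Reasoning

-- A nonempty constant list has the same set as the one-entry list of its head.
∣setOf-constant∣≤1 : ∀ {n} {xs : List (Fin n)} → AllPairs _≡_ xs →
                     ∣ setOf xs ∣ ≤ 1
∣setOf-constant∣≤1 {n} {[]}     _  = ℕ.≤-trans (∣setOf∣≤length {n} []) z≤n
∣setOf-constant∣≤1 {xs = x ∷ xs} ps =
  subst (λ S → ∣ S ∣ ≤ 1)
    (setOf-cong {xs = x ∷ []} (λ { (here eq) → here eq })
      (λ y∈ → here (allPairs-≡⇒≡ ps y∈ (here refl))))
    (∣setOf∣≤length (x ∷ []))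

-- With at least two vertices an edge cannot shrink to one point. This is what separates the two
-- kinds of edges of the product.
edge⇒¬constant : ∀ {k n} → 2 ≤ k → (F : Hypergraph k n) {xs : List (Fin n)} →
                 Edge F (setOf xs) → ¬ AllPairs _≡_ xs
edge⇒¬constant 2≤k F e ps = ℕ.<⇒≱ 2≤k
  (subst (_≤ 1) (uniform F e) (∣setOf-constant∣≤1 ps))

-- Enumerating subsets and the edges through a vertex

∈-subsets : ∀ {n} (S : Subset n) → S ∈ˡ subsets n
∈-subsets Vec.[]            = here refl
∈-subsets (outside Vec.∷ S) = ∈-++⁺ˡ (∈-map⁺ _ (∈-subsets S))
∈-subsets (inside  Vec.∷ S) = ∈-++⁺ʳ _ (∈-map⁺ _ (∈-subsets S))

subsets-unique : ∀ n → Unique (subsets n)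
subsets-unique zero    = [] ∷ []
subsets-unique (suc n) = Unique.++⁺
  (Unique.map⁺ (λ { refl → refl }) (subsets-unique n))
  (Unique.map⁺ (λ { refl → refl }) (subsets-unique n))
  λ { (x∈ , y∈) → disjoint (∈-map⁻ _ x∈) (∈-map⁻ _ y∈) }
  where
  disjoint : ∀ {S} → ∃ (λ T → T ∈ˡ subsets n × S ≡ outside Vec.∷ T) →
             ¬ ∃ (λ T → T ∈ˡ subsets n × S ≡ inside Vec.∷ T)
  disjoint (_ , _ , refl) (_ , _ , ())

-- `degree F i` is by definition the length of this list.
edgesAt : ∀ {k n} → Hypergraph k n → Fin n → List (Subset n)
edgesAt {n = n} F i = filter (λ e → Edge? F e ×-dec (i ∈? e)) (subsets n)

module _ {k n} (F : Hypergraph k n) (i : Fin n) where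

  ∈-edgesAt⁺ : ∀ {e} → Edge F e → i ∈ e → e ∈ˡ edgesAt F i
  ∈-edgesAt⁺ {e} Fe i∈e =
    ∈-filter⁺ (λ e → Edge? F e ×-dec (i ∈? e)) (∈-subsets e) (Fe , i∈e)

  ∈-edgesAt⁻ : ∀ {e} → e ∈ˡ edgesAt F i → Edge F e × i ∈ e
  ∈-edgesAt⁻ e∈ =
    proj₂ (∈-filter⁻ (λ e → Edge? F e ×-dec (i ∈? e)) {xs = subsets n} e∈)

  edgesAt-unique : Unique (edgesAt F i)
  edgesAt-unique = Unique.filter⁺ _ (subsets-unique n)

-- Edges along one coordinate of a product

-- f is the coordinate that varies along an edge and g the one that is constant;
-- this covers both kinds of edges of a Cartesian product.
module Layers {k N a b : ℕ} (f : Fin N → Fin a) (g : Fin N → Fin b)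
  (pair : Fin a → Fin b → Fin N)
  (f-pair : ∀ i j → f (pair i j) ≡ i) (g-pair : ∀ i j → g (pair i j) ≡ j)
  (pair-f-g : ∀ x → pair (f x) (g x) ≡ x)
  (F : Hypergraph k a) where

  -- Instantiated for `G` or for `H`, this is definitionally one of the two alternatives in the edge
  -- set of `G □ H`.
  LayerEdge : Subset N → Set
  LayerEdge S =
    AllPairs _≡_ (List.map g (elements S)) × Edge F (setOf (List.map f (elements S)))

  -- Both conditions depend only on the set of entries, so they can be tested on the tuple itself,
  -- repetitions included.
  layerEdge-setOf : ∀ xs → LayerEdge (setOf xs) ⇔
    (Edge F (setOf (List.map f xs)) × AllPairs _≡_ (List.map g xs))
  layerEdge-setOf xs = mk⇔
    (λ (ps , e) → subst (Edge F) (setOf-map-elements f xs) e ,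
                  allPairs-≡-resp-⊇ (map⁺ g (⊆-elements-setOf xs)) ps)
    (λ (e , ps) → allPairs-≡-resp-⊇ (map⁺ g (elements-setOf-⊆ xs)) ps ,
                  subst (Edge F) (sym (setOf-map-elements f xs)) e)

  -- A squeeze: `k` entries give at most `k` vertices, and the image under `f`, being an edge,
  -- already has `k`. This supplies the size condition of `□`.
  ∣setOf∣≡k : ∀ xs → length xs ≡ k → Edge F (setOf (List.map f xs)) →
              ∣ setOf xs ∣ ≡ k
  ∣setOf∣≡k xs len e = ℕ.≤-antisym
    (subst (∣ setOf xs ∣ ≤_) len (∣setOf∣≤length xs))
    (subst (_≤ ∣ setOf xs ∣) (uniform F e) (∣setOf-map∣≤ f xs))

  row : Fin b → Subset a → List (Fin N)
  row j e = List.map (flip pair j) (elements e)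

  layer : Fin b → Subset a → Subset N
  layer j e = setOf (row j e)

  map-f-row : ∀ j e → List.map f (row j e) ≡ elements e
  map-f-row j e = trans (sym (map-∘ (elements e)))
    (trans (map-cong (λ i → f-pair i j) (elements e)) (map-id (elements e)))

  setOf-map-f-row : ∀ j e → setOf (List.map f (row j e)) ≡ e
  setOf-map-f-row j e = trans (cong setOf (map-f-row j e)) (setOf-elements e)

  -- Projecting by `f` recovers `e` from its copy.
  layer-injective : ∀ j {e e′} → layer j e ≡ layer j e′ → e ≡ e′
  layer-injective j {e} {e′} eq = begin
    e                                            ≡⟨ setOf-map-f-row j e ⟨
    setOf (List.map f (row j e))                 ≡⟨ setOf-map-elements f (row j e) ⟨
    setOf (List.map f (elements (layer j e)))    ≡⟨ cong (setOf ∘ List.map f ∘ elements) eq ⟩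
    setOf (List.map f (elements (layer j e′)))   ≡⟨ setOf-map-elements f (row j e′) ⟩
    setOf (List.map f (row j e′))                ≡⟨ setOf-map-f-row j e′ ⟩
    e′                                           ∎
    where open ≡-Reasoning

  g-row : ∀ j e {i} → i ∈ˡ List.map g (row j e) → i ≡ j
  g-row j e i∈ with ∈-map⁻ g i∈
  ... | y , y∈ , refl with ∈-map⁻ (flip pair j) y∈
  ...   | i , _ , refl = g-pair i j

  layer-edge : ∀ j {e} → Edge F e → LayerEdge (layer j e)
  layer-edge j {e} Fe = from (layerEdge-setOf (row j e))
    ( subst (Edge F) (sym (setOf-map-f-row j e)) Fe
    , ≡⇒allPairs-≡ _ (λ x∈ y∈ → trans (g-row j e x∈) (sym (g-row j e y∈))))

  ∣layer∣ : ∀ j {e} → Edge F e → ∣ layer j e ∣ ≡ k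
  ∣layer∣ j {e} Fe = ∣setOf∣≡k (row j e)
    (trans (length-map _ (elements e)) (trans (length-elements e) (uniform F Fe)))
    (subst (Edge F) (sym (setOf-map-f-row j e)) Fe)

  ∈-layer : ∀ x {e} → f x ∈ e → x ∈ layer (g x) e
  ∈-layer x fx∈e = subst (_∈ layer (g x) _) (pair-f-g x)
    (∈-setOf⁺ (∈-map⁺ (flip pair (g x)) (∈-elements⁺ fx∈e)))

  -- A set that is constant under `g` lies entirely in the layer of its member `x`, where the
  -- `f`-coordinate determines the vertex. Hence every layer edge is the copy of its projection: the
  -- surjective half of the bijection of edges.
  layer-shadow : ∀ {x S} → x ∈ S → AllPairs _≡_ (List.map g (elements S)) →
                 layer (g x) (setOf (List.map f (elements S))) ≡ S
  layer-shadow {x} {S} x∈S ps = ⊆-antisym ⊆S S⊆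
    where
    g-constant : ∀ {y} → y ∈ S → g y ≡ g x
    g-constant y∈S = allPairs-≡⇒≡ ps
      (∈-map⁺ g (∈-elements⁺ y∈S)) (∈-map⁺ g (∈-elements⁺ x∈S))

    ⊆S : ∀ {y} → y ∈ layer (g x) (setOf (List.map f (elements S))) → y ∈ S
    ⊆S y∈ with ∈-map⁻ (flip pair (g x)) (∈-setOf⁻ _ y∈)
    ... | i , i∈ , refl with ∈-map⁻ f (elements-setOf-⊆ _ i∈)
    ...   | z , z∈ , refl = subst (_∈ S)
      (trans (sym (pair-f-g z)) (cong (pair (f z)) (g-constant z∈S))) z∈S
      where z∈S = ∈-elements⁻ S z∈

    S⊆ : ∀ {y} → y ∈ S → y ∈ layer (g x) (setOf (List.map f (elements S)))
    S⊆ {y} y∈S = subst (λ j → y ∈ layer j _) (g-constant y∈S)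
      (∈-layer y (∈-setOf⁺ (∈-map⁺ f (∈-elements⁺ y∈S))))

  layersAt : Fin N → List (Subset N)
  layersAt x = List.map (layer (g x)) (edgesAt F (f x))

  layersAt-unique : ∀ x → Unique (layersAt x)
  layersAt-unique x =
    Unique.map⁺ (layer-injective (g x)) (edgesAt-unique F (f x))

  ∈-layersAt⁺ : ∀ {x S} → x ∈ S → LayerEdge S → S ∈ˡ layersAt x
  ∈-layersAt⁺ {x} {S} x∈S (ps , e) = subst (_∈ˡ layersAt x) (layer-shadow x∈S ps)
    (∈-map⁺ (layer (g x))
      (∈-edgesAt⁺ F (f x) e (∈-setOf⁺ (∈-map⁺ f (∈-elements⁺ x∈S)))))

  ∈-layersAt⁻ : ∀ {x S} → S ∈ˡ layersAt x → ∣ S ∣ ≡ k × LayerEdge S × x ∈ S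
  ∈-layersAt⁻ {x} S∈ with ∈-map⁻ (layer (g x)) S∈
  ... | e , e∈ , refl with ∈-edgesAt⁻ F (f x) e∈
  ...   | Fe , fx∈e = ∣layer∣ (g x) Fe , layer-edge (g x) Fe , ∈-layer x fx∈e

  length-layersAt : ∀ x → length (layersAt x) ≡ degree F (f x)
  length-layersAt x = length-map (layer (g x)) (edgesAt F (f x))

-- The Cartesian product

module _ {k n m} (2≤k : 2 ≤ k) (G : Hypergraph k n) (H : Hypergraph k m) where

  private
    q : Fin (n ℕ.* m) → Fin n
    q = quotient m

    r : Fin (n ℕ.* m) → Fin m
    r = remainder {n} m

    q-combine : ∀ (i : Fin n) (j : Fin m) → q (combine i j) ≡ i
    q-combine i j = cong proj₁ (remQuot-combine i j)

    r-combine : ∀ (i : Fin n) (j : Fin m) → r (combine i j) ≡ j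
    r-combine i j = cong proj₂ (remQuot-combine i j)

    module LG = Layers q r combine q-combine r-combine (combine-remQuot {n} m) G
    module LH = Layers r q (flip combine)
      (flip r-combine) (flip q-combine) (combine-remQuot {n} m) H

  -- The alternatives are listed with `G` first, and each conjunction is ordered like the factors of
  -- the corresponding direct product, so that the tensor formula can be read off.
  □-edge-setOf : ∀ xs → length xs ≡ k → Edge (G □ H) (setOf xs) ⇔
    ( (Edge G (setOf (List.map q xs)) × AllPairs _≡_ (List.map r xs))
    ⊎ (AllPairs _≡_ (List.map q xs) × Edge H (setOf (List.map r xs))))
  □-edge-setOf xs len = mk⇔
    (λ { (_ , inj₁ e) → let e′ , ps = to (LH.layerEdge-setOf xs) e in inj₂ (ps , e′)
       ; (_ , inj₂ e) → inj₁ (to (LG.layerEdge-setOf xs) e) })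
    (λ { (inj₁ (e , ps)) →
           LG.∣setOf∣≡k xs len e , inj₂ (from (LG.layerEdge-setOf xs) (e , ps))
       ; (inj₂ (ps , e)) →
           LH.∣setOf∣≡k xs len e , inj₁ (from (LH.layerEdge-setOf xs) (e , ps)) })

  degree-□ : ∀ x → degree (G □ H) x ≡ degree G (q x) ℕ.+ degree H (r x)
  degree-□ x = begin
    degree (G □ H) x                           ≡⟨ length-set≡ (edgesAt-unique (G □ H) x)
                                                    layers-unique ⊆layers layers⊆ ⟩
    length (LG.layersAt x ++ LH.layersAt x)    ≡⟨ length-++ (LG.layersAt x) ⟩
    length (LG.layersAt x) ℕ.+ length (LH.layersAt x)
                                               ≡⟨ cong₂ ℕ._+_ (LG.length-layersAt x)
                                                              (LH.length-layersAt x) ⟩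
    degree G (q x) ℕ.+ degree H (r x)          ∎
    where
    open ≡-Reasoning

    layers-unique : Unique (LG.layersAt x ++ LH.layersAt x)
    layers-unique = Unique.++⁺ (LG.layersAt-unique x) (LH.layersAt-unique x)
      -- A set in both lists would project under `q` to an edge of `G` and also be constant under
      -- `q`.
      λ (S∈G , S∈H) →
        let _ , (_  , e) , _ = LG.∈-layersAt⁻ S∈G
            _ , (ps , _) , _ = LH.∈-layersAt⁻ S∈H
        in edge⇒¬constant 2≤k G e ps

    ⊆layers : edgesAt (G □ H) x ⊆ LG.layersAt x ++ LH.layersAt x
    ⊆layers S∈ with ∈-edgesAt⁻ (G □ H) x S∈
    ... | (_ , inj₁ e) , x∈S = ∈-++⁺ʳ (LG.layersAt x) (LH.∈-layersAt⁺ x∈S e)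
    ... | (_ , inj₂ e) , x∈S = ∈-++⁺ˡ (LG.∈-layersAt⁺ x∈S e)

    layers⊆ : LG.layersAt x ++ LH.layersAt x ⊆ edgesAt (G □ H) x
    layers⊆ S∈ with ∈-++⁻ (LG.layersAt x) S∈
    ... | inj₁ S∈G = let eq , e , x∈S = LG.∈-layersAt⁻ S∈G in
                     ∈-edgesAt⁺ (G □ H) x (eq , inj₂ e) x∈S
    ... | inj₂ S∈H = let eq , e , x∈S = LH.∈-layersAt⁻ S∈H in
                     ∈-edgesAt⁺ (G □ H) x (eq , inj₁ e) x∈S

-- Tensor entries

infix 8 _when_
-- An Iverson bracket scaled by `p`.
_when_ : ∀ {P : Set} → ℚ → Dec P → ℚ
p when P? = if does P? then p else 0ℚ

-- Deciders of equivalent propositions give the same Boolean, so the decider of `G □ H` can be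
-- exchanged for one built from those of `G` and `H`.
when-⇔ : ∀ {P Q : Set} (P? : Dec P) (Q? : Dec Q) {p} →
         P ⇔ Q → p when P? ≡ p when Q?
when-⇔ P? Q? {p} P⇔Q = cong (if_then p else 0ℚ) (does-⇔ P⇔Q P? Q?)

when-*-1 : ∀ {P Q : Set} (P? : Dec P) (Q? : Dec Q) {p} →
           p when P? * 1ℚ when Q? ≡ p when (P? ×-dec Q?)
when-*-1 (no _)  Q?          = ℚ.*-zeroˡ (1ℚ when Q?)
when-*-1 (yes _) (yes _) {p} = ℚ.*-identityʳ p
when-*-1 (yes _) (no _)  {p} = ℚ.*-zeroʳ p

1-when-* : ∀ {P Q : Set} (P? : Dec P) (Q? : Dec Q) {p} →
           1ℚ when P? * p when Q? ≡ p when (P? ×-dec Q?)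
1-when-* (yes _) Q? {p} = ℚ.*-identityˡ (p when Q?)
1-when-* (no _)  Q? {p} = ℚ.*-zeroˡ (p when Q?)

-- Exclusiveness prevents the value `p + p` on the right.
when-⊎ : ∀ {P Q : Set} (P? : Dec P) (Q? : Dec Q) {p} →
         ¬ (P × Q) → p when (P? ⊎-dec Q?) ≡ p when P? + p when Q?
when-⊎ (yes P) (yes Q)     ¬P×Q = contradiction (P , Q) ¬P×Q
when-⊎ (yes _) (no _)  {p} _    = sym (ℚ.+-identityʳ p)
when-⊎ (no _)  Q?      {p} _    = sym (ℚ.+-identityˡ (p when Q?))

when-+ : ∀ {P : Set} (P? : Dec P) {p q} → (p + q) when P? ≡ p when P? + q when P?
when-+ (yes _) = refl
when-+ (no _)  = refl

-- `_/_` reduces fractions by a gcd, which does not compute on variables; the equation is therefore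
-- checked on unnormalised fractions with denominator 1.
/1-homo-+ : ∀ a b → + (a ℕ.+ b) / 1 ≡ + a / 1 + + b / 1
/1-homo-+ a b = toℚᵘ-injective (begin-equality
  toℚᵘ (+ (a ℕ.+ b) / 1)                  ≃⟨ toℚᵘ-fromℚᵘ (+ᵘ (a ℕ.+ b)) ⟩
  +ᵘ (a ℕ.+ b)                            ≃⟨ ℚᵘ.*≡* (cong (ℤ._* + 1) numerators) ⟩
  +ᵘ a ℚᵘ.+ +ᵘ b                          ≃⟨ ℚᵘ.+-cong (toℚᵘ-fromℚᵘ (+ᵘ a))
                                                       (toℚᵘ-fromℚᵘ (+ᵘ b)) ⟨
  toℚᵘ (+ a / 1) ℚᵘ.+ toℚᵘ (+ b / 1)      ≃⟨ toℚᵘ-homo-+ (+ a / 1) (+ b / 1) ⟨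
  toℚᵘ (+ a / 1 + + b / 1)                ∎)
  where
  open ℚᵘ.≤-Reasoning

  +ᵘ : ℕ → ℚᵘ.ℚᵘ
  +ᵘ c = ℚᵘ.mkℚᵘ (+ c) 0

  numerators : + (a ℕ.+ b) ≡ + a ℤ.* + 1 ℤ.+ + b ℤ.* + 1
  numerators = sym (cong₂ ℤ._+_ (ℤ.*-identityʳ (+ a)) (ℤ.*-identityʳ (+ b)))

-- Diagonal and adjacency entries at projected tuples

constant? : ∀ {n} (xs : List (Fin n)) → Dec (AllPairs _≡_ xs)
constant? = allPairs? _≟_

-- Turns the comparison with the first index into a condition on the whole list, the form that
-- splits over the two coordinates.
diagonal-∷ : ∀ {k N} (d : Fin N → ℚ) i (is : Vec (Fin N) k) →
             diagonal d (i Vec.∷ is) ≡ d i when constant? (toList (i Vec.∷ is))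
diagonal-∷ d i is = when-⇔ (VecAll.all? (i ≟_) is) (constant? _) (mk⇔
  (λ i≡is → let ps = VecAll.toList⁺ i≡is in ≡⇒allPairs-≡ _ λ x∈ y∈ →
    trans (sym (All.lookup (refl ∷ ps) x∈)) (All.lookup (refl ∷ ps) y∈))
  (VecAll.toList⁻ ∘ AllPairs.head))

diagonal-map : ∀ {k N M} (d : Fin M → ℚ) (f : Fin N → Fin M) i (is : Vec (Fin N) k) →
  diagonal d (Vec.map f (i Vec.∷ is)) ≡
  d (f i) when constant? (List.map f (toList (i Vec.∷ is)))
diagonal-map d f i is = trans (diagonal-∷ d (f i) (Vec.map f is))
  (cong (λ ys → d (f i) when constant? ys) (toList-map f (i Vec.∷ is)))

1/[k-1]! : ℕ → ℚ
1/[k-1]! k = _/_ (+ 1) ((k ∸ 1) !) {{(k ∸ 1) !≢0}}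

𝔸-map : ∀ {k N M} (F : Hypergraph k M) (f : Fin N → Fin M) (is : Vec (Fin N) k) →
  𝔸 F (Vec.map f is) ≡ 1/[k-1]! k when Edge? F (setOf (List.map f (toList is)))
𝔸-map {k} F f is =
  cong (λ ys → 1/[k-1]! k when Edge? F (setOf ys)) (toList-map f is)

degreeℚ : ∀ {k n} → Hypergraph k n → Fin n → ℚ
degreeℚ F i = + degree F i / 1

-- A vertex of the product is determined by its two coordinates.
constant-product : ∀ {n m} (xs : List (Fin (n ℕ.* m))) → AllPairs _≡_ xs ⇔
  (AllPairs _≡_ (List.map (quotient {n} m) xs) ×
   AllPairs _≡_ (List.map (remainder {n} m) xs))
constant-product {n} {m} xs = mk⇔
  (λ ps → constant-map (quotient {n} m) ps , constant-map (remainder {n} m) ps)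
  (λ (ps , qs) → ≡⇒allPairs-≡ xs λ {x} {y} x∈ y∈ →
    trans (sym (combine-remQuot {n} m x)) (trans
      (cong₂ combine (allPairs-≡⇒≡ ps (∈-map⁺ _ x∈) (∈-map⁺ _ y∈))
                     (allPairs-≡⇒≡ qs (∈-map⁺ _ x∈) (∈-map⁺ _ y∈)))
      (combine-remQuot {n} m y)))
  where
  constant-map : ∀ {A B : Set} (f : A → B) {xs} →
                 AllPairs _≡_ xs → AllPairs _≡_ (List.map f xs)
  constant-map f ps = AllPairsP.map⁺ (AllPairs.map (cong f) ps)

-- Adjacency and degree tensors of the product

module _ {k n m} (2≤k : 2 ≤ k) (G : Hypergraph k n) (H : Hypergraph k m) where

  𝔸-□ : 𝔸 (G □ H) ≗ 𝔸 G ⊗ 𝕀 m ⊕ 𝕀 n ⊗ 𝔸 H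
  -- The empty tuple would force `k` to be 0, and `2 ≤ 0` is empty; so the junk value of `diagonal`
  -- at order 0 never occurs.
  𝔸-□ xs@(x Vec.∷ xs′) = begin
    c when Edge? (G □ H) (setOf (toList xs))
      ≡⟨ when-⇔ (Edge? (G □ H) _) ((eG? ×-dec cr?) ⊎-dec (cq? ×-dec eH?))
           (□-edge-setOf 2≤k G H (toList xs) (length-toList xs)) ⟩
    c when ((eG? ×-dec cr?) ⊎-dec (cq? ×-dec eH?))
      ≡⟨ when-⊎ (eG? ×-dec cr?) (cq? ×-dec eH?)
           (λ ((e , _) , (ps , _)) → edge⇒¬constant 2≤k G e ps) ⟩
    c when (eG? ×-dec cr?) + c when (cq? ×-dec eH?)
      ≡⟨ cong₂ _+_ (when-*-1 eG? cr?) (1-when-* cq? eH?) ⟨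
    c when eG? * 1ℚ when cr? + 1ℚ when cq? * c when eH?
      ≡⟨ cong₂ _+_
           (cong₂ _*_ (𝔸-map G q xs) (diagonal-map (λ _ → 1ℚ) r x xs′))
           (cong₂ _*_ (diagonal-map (λ _ → 1ℚ) q x xs′) (𝔸-map H r xs)) ⟨
    (𝔸 G ⊗ 𝕀 m ⊕ 𝕀 n ⊗ 𝔸 H) xs
      ∎
    where
    open ≡-Reasoning
    c = 1/[k-1]! k
    q = quotient {n} m
    r = remainder {n} m
    eG? = Edge? G (setOf (List.map q (toList xs)))
    eH? = Edge? H (setOf (List.map r (toList xs)))
    cq? = constant? (List.map q (toList xs))
    cr? = constant? (List.map r (toList xs))

  𝔻-□ : 𝔻 (G □ H) ≗ 𝔻 G ⊗ 𝕀 m ⊕ 𝕀 n ⊗ 𝔻 H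
  𝔻-□ xs@(x Vec.∷ xs′) = begin
    𝔻 (G □ H) xs
      ≡⟨ diagonal-∷ (degreeℚ (G □ H)) x xs′ ⟩
    degreeℚ (G □ H) x when constant? (toList xs)
      ≡⟨ when-⇔ (constant? (toList xs)) (cq? ×-dec cr?)
           (constant-product {n} {m} (toList xs)) ⟩
    degreeℚ (G □ H) x when (cq? ×-dec cr?)
      ≡⟨ cong (_when (cq? ×-dec cr?)) (trans
           (cong (λ d → + d / 1) (degree-□ 2≤k G H x))
           (/1-homo-+ (degree G (q x)) (degree H (r x)))) ⟩
    (dG + dH) when (cq? ×-dec cr?)
      ≡⟨ when-+ (cq? ×-dec cr?) ⟩
    dG when (cq? ×-dec cr?) + dH when (cq? ×-dec cr?)
      -- Each degree carries both constancy conditions: one becomes the test of its own diagonal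
      -- tensor, the other that of the unit tensor.
      ≡⟨ cong₂ _+_ (when-*-1 cq? cr?) (1-when-* cq? cr?) ⟨
    dG when cq? * 1ℚ when cr? + 1ℚ when cq? * dH when cr?
      ≡⟨ cong₂ _+_
           (cong₂ _*_ (diagonal-map (degreeℚ G) q x xs′) (diagonal-map (λ _ → 1ℚ) r x xs′))
           (cong₂ _*_ (diagonal-map (λ _ → 1ℚ) q x xs′) (diagonal-map (degreeℚ H) r x xs′)) ⟨
    (𝔻 G ⊗ 𝕀 m ⊕ 𝕀 n ⊗ 𝔻 H) xs
      ∎
    where
    open ≡-Reasoning
    q = quotient {n} m
    r = remainder {n} m
    dG = degreeℚ G (q x)
    dH = degreeℚ H (r x)
    cq? = constant? (List.map q (toList xs))
    cr? = constant? (List.map r (toList xs))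

-- Bilinearity of the direct product

module _ {k n m : ℕ} (S S′ : Tensor k n) (T T′ : Tensor k m) where

  open ℚSolver.+-*-Solver

  -- At a fixed tuple this is a polynomial identity in six rationals, two of them entries of unit
  -- tensors. It regroups the sum of the degree and adjacency formulas.
  ⊕-⊗-interchange :
    (S ⊗ 𝕀 m ⊕ 𝕀 n ⊗ T) ⊕ (S′ ⊗ 𝕀 m ⊕ 𝕀 n ⊗ T′) ≗
    (S ⊕ S′) ⊗ 𝕀 m ⊕ 𝕀 n ⊗ (T ⊕ T′)
  ⊕-⊗-interchange xs = solve 6
    (λ s s′ t t′ i j → (s :* j :+ i :* t) :+ (s′ :* j :+ i :* t′)
                    := (s :+ s′) :* j :+ i :* (t :+ t′)) refl
    (S qs) (S′ qs) (T rs) (T′ rs) (𝕀 n qs) (𝕀 m rs)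
    where
    qs = Vec.map (quotient m) xs
    rs = Vec.map (remainder {n} m) xs

  ⊖-⊗-interchange :
    (S ⊗ 𝕀 m ⊕ 𝕀 n ⊗ T) ⊖ (S′ ⊗ 𝕀 m ⊕ 𝕀 n ⊗ T′) ≗
    (S ⊖ S′) ⊗ 𝕀 m ⊕ 𝕀 n ⊗ (T ⊖ T′)
  ⊖-⊗-interchange xs = solve 6
    (λ s s′ t t′ i j → (s :* j :+ i :* t) :- (s′ :* j :+ i :* t′)
                    := (s :- s′) :* j :+ i :* (t :- t′)) refl
    (S qs) (S′ qs) (T rs) (T′ rs) (𝕀 n qs) (𝕀 m rs)
    where
    qs = Vec.map (quotient m) xs
    rs = Vec.map (remainder {n} m) xs

theorem3p1 : ∀ {k n m : ℕ} → 2 ≤ k → (G : Hypergraph k n) (H : Hypergraph k m) →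
    (𝔸 (G □ H) ≗ 𝔸 G ⊗ 𝕀 m ⊕ 𝕀 n ⊗ 𝔸 H)
    × (𝔻 (G □ H) ≗ 𝔻 G ⊗ 𝕀 m ⊕ 𝕀 n ⊗ 𝔻 H)
    × (𝕃 (G □ H) ≗ 𝕃 G ⊗ 𝕀 m ⊕ 𝕀 n ⊗ 𝕃 H)
    × (ℚˢ (G □ H) ≗ ℚˢ G ⊗ 𝕀 m ⊕ 𝕀 n ⊗ ℚˢ H)
theorem3p1 2≤k G H =
  𝔸-□ 2≤k G H ,
  𝔻-□ 2≤k G H ,
  -- `𝕃` is the entrywise difference of `𝔻` and `𝔸`, so the first two claims are subtracted and then
  -- regrouped.
  (λ xs → trans (cong₂ _-_ (𝔻-□ 2≤k G H xs) (𝔸-□ 2≤k G H xs))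
                (⊖-⊗-interchange (𝔻 G) (𝔸 G) (𝔻 H) (𝔸 H) xs)) ,
  (λ xs → trans (cong₂ _+_ (𝔻-□ 2≤k G H xs) (𝔸-□ 2≤k G H xs))
                (⊕-⊗-interchange (𝔻 G) (𝔸 G) (𝔻 H) (𝔸 H) xs))
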